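{- Let $p$ be a prime, $n\ge 1$ an integer and $q=p^n$. Suppose a permutation $f$ of $\mathbb{F}_q$ has Carlitz rank $r>0$. Then its additive index satisfies $$\mathrm{AddInd}(f)\ \ge\ \min\left\{\frac{q}{r},\frac{q-2r}{2}\right\}.$$ Further, if $r=1$ and $q>4$, then $\mathrm{AddInd}(f)=q$.
   Context: Carlitz rank: by a theorem of Carlitz, for $q\ge 3$ the group of permutations of $\mathbb{F}_q$ under composition is generated by the inversion map ($0\mapsto 0$, $x\mapsto x^{ -1}$ for $x\ne 0$; i.e. $x\mapsto x^{q-2}$) and all affine maps $x\mapsto \alpha x+\beta$ with $\alpha,\beta\in\mathbb{F}_q$, $\alpha\neq 0$. The Carlitz rank $\mathrm{Crk}(f)$ of a permutation $f$ of $\mathbb{F}_q$ is the minimum number of inversions needed to write $f$ as a composition of inversions and such affine maps. In particular $\mathrm{Crk}(f)=0$ if and only if $f(x)=ax+b$ for some $a\neq 0$, $b\in\mathbb{F}_q$. (For $q=2$ every permutation is affine, of Carlitz rank $0$.) Additive index: view $\mathbb{F}_q$ as an $n$-dimensional vector space over $\mathbb{F}_p$. A map $f:\mathbb{F}_q\to\mathbb{F}_q$ is of codimension at most $k$ ($0\le k\le n$) if there are an $\mathbb{F}_p$-linear map $M:\mathbb{F}_q\to\mathbb{F}_q$ (equivalently, a map induced by a linearised polynomial $\sum_j a_jX^{p^j}$, $a_j\in\mathbb{F}_q$) and an $\mathbb{F}_p$-subspace $U$ of $\mathbb{F}_q$ of dimension $n-k$ such that $f-M$ is constant on each coset of $U$.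 The codimension $\mathrm{codim}\, f$ is the smallest such $k$, and $\mathrm{AddInd}(f)=p^{\mathrm{codim}\, f}$. -}

module Defs where

open import Algebra.Bundles using (CommutativeRing)
import Algebra.Definitions.RawMonoid as MonoidOps
open import Algebra.Structures using (IsCommutativeRing)
open import Data.Fin.Base using (Fin; toℕ)
import Data.Fin.Properties as Fin
open import Data.List.Base using (List; []; _∷_)
open import Data.Nat.Base using (ℕ; zero; suc; _≤_; _^_; _∸_; z≤n; s≤s)
open import Data.Nat.Properties using (_≤?_; ≤-refl; n∸n≡0) renaming (_≟_ to _≟ᴺ_)
open import Data.Product.Base using (∃; ∃-syntax; _×_; _,_; proj₁; proj₂)
open import Data.Vec.Base using (Vec; []; _∷_; foldr′; zipWith; lookup; tabulate)
open import Data.Vec.Properties using (lookup∘tabulate)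
open import Data.Vec.Relation.Unary.All using (All; []; _∷_)
import Data.Vec.Relation.Unary.All as All
open import Function.Base using (id; _∘_)
open import Function.Bundles using (_↔_; Inverse)
open import Level using (0ℓ)
open import Relation.Binary.Definitions using (DecidableEquality)
open import Relation.Binary.PropositionalEquality
  using (_≡_; _≢_; _≗_; refl; sym; trans; cong; cong₂; subst)
open import Relation.Nullary.Decidable
  using (Dec; yes; no; map′; ¬?; _×-dec_; _→-dec_; decidable-stable)
open import Relation.Nullary.Negation using (contradiction)
open import Relation.Unary using (Pred; _∈_; Decidable)

-- Since stdlib has no discrete fields, a field with q elements is a commutative
-- ring up to _≡_ with inverses and an enumeration.  The junk value of _⁻¹ at 0#
-- is fixed so that _⁻¹ is the inversion map x ↦ x^(q-2) of Carlitz's theorem.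
record FiniteField (q : ℕ) : Set₁ where
  infix  8 _⁻¹
  infix  8 -_
  infixl 7 _*_
  infixl 6 _+_
  field
    Carrier           : Set
    _+_ _*_           : Carrier → Carrier → Carrier
    -_                : Carrier → Carrier
    0# 1#             : Carrier
    _⁻¹               : Carrier → Carrier
    isCommutativeRing : IsCommutativeRing _≡_ _+_ _*_ -_ 0# 1#
    0≢1               : 0# ≢ 1#
    ⁻¹-inverse        : ∀ x → x ≢ 0# → x * x ⁻¹ ≡ 1#
    ⁻¹-zero           : 0# ⁻¹ ≡ 0#
    enumeration       : Carrier ↔ Fin q

  commutativeRing : CommutativeRing 0ℓ 0ℓ
  commutativeRing = record { isCommutativeRing = isCommutativeRing }

  open CommutativeRing commutativeRing public
    using (_-_; +-rawMonoid; +-identityˡ; +-identityʳ; +-assoc; -‿inverseˡ)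

record Least (P : ℕ → Set₁) (k : ℕ) : Set₁ where
  field
    holds   : P k
    minimal : ∀ j → P j → k ≤ j

module CarlitzRank {q : ℕ} (K : FiniteField q) where
  open FiniteField K

  data Generator : Set where
    inversion : Generator
    affine    : (α β : Carrier) → α ≢ 0# → Generator

  ⟦_⟧ : Generator → Carrier → Carrier
  ⟦ inversion ⟧    x = x ⁻¹
  ⟦ affine α β _ ⟧ x = α * x + β

  compose : List Generator → Carrier → Carrier
  compose []       = id
  compose (g ∷ gs) = ⟦ g ⟧ ∘ compose gs

  inversions : List Generator → ℕ
  inversions []                  = 0
  inversions (inversion ∷ gs)    = suc (inversions gs)
  inversions (affine _ _ _ ∷ gs) = inversions gs

  record HasCarlitzRank (f : Carrier → Carrier) (r : ℕ) : Set where
    field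
      attained : ∃[ gs ] compose gs ≗ f × inversions gs ≡ r
      minimal  : ∀ gs → compose gs ≗ f → r ≤ inversions gs

module AdditiveIndex (p n : ℕ) (K : FiniteField (p ^ n)) where
  open FiniteField K
  open MonoidOps +-rawMonoid using () renaming (_×_ to _×ᴺ_)

  -- The prime field F_p is represented by its residues 0, …, p-1, acting on
  -- F_q by repeated addition.
  infixr 8 _·_
  _·_ : Fin p → Carrier → Carrier
  c · x = toℕ c ×ᴺ x

  record IsLinear (M : Carrier → Carrier) : Set where
    field
      +-homo : ∀ x y → M (x + y) ≡ M x + M y
      ·-homo : ∀ c x → M (c · x) ≡ c · M x

  record IsSubspace (U : Pred Carrier 0ℓ) : Set where
    field
      0#-closed : 0# ∈ U
      +-closed  : ∀ x y → x ∈ U → y ∈ U → x + y ∈ U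
      ·-closed  : ∀ c x → x ∈ U → c · x ∈ U

  linearCombination : ∀ {d} → Vec (Fin p) d → Vec Carrier d → Carrier
  linearCombination cs bs = foldr′ _+_ 0# (zipWith _·_ cs bs)

  record IsBasis (U : Pred Carrier 0ℓ) {d : ℕ} (bs : Vec Carrier d) : Set where
    field
      members     : All U bs
      independent : ∀ cs → linearCombination cs bs ≡ 0# → All (λ c → toℕ c ≡ 0) cs
      spanning    : ∀ x → x ∈ U → ∃[ cs ] linearCombination cs bs ≡ x

  HasDimension : Pred Carrier 0ℓ → ℕ → Set
  HasDimension U d = ∃[ bs ] IsBasis U {d} bs

  ConstantOnCosets : Pred Carrier 0ℓ → (Carrier → Carrier) → Set
  ConstantOnCosets U g = ∀ x y → x - y ∈ U → g x ≡ g y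

  record CodimAtMost (f : Carrier → Carrier) (k : ℕ) : Set₁ where
    field
      k≤n          : k ≤ n
      M            : Carrier → Carrier
      M-linear     : IsLinear M
      U            : Pred Carrier 0ℓ
      U-subspace   : IsSubspace U
      U-dimension  : HasDimension U (n ∸ k)
      f-M-constant : ConstantOnCosets U (λ x → f x - M x)

  -- The remaining lemmas show that a least codimension exists, by deciding
  -- CodimAtMost through an exhaustive search for M and for a basis of U.

  private
    open Inverse enumeration using (to; from; strictlyInverseʳ)

    _≟_ : DecidableEquality Carrier
    x ≟ y = map′ (λ eq → trans (sym (strictlyInverseʳ x)) (trans (cong from eq) (strictlyInverseʳ y)))
                 (cong to) (to x Fin.≟ to y)

    any-Carrier? : ∀ {ℓ} {P : Pred Carrier ℓ} → Decidable P → Dec (∃ P)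
    any-Carrier? {P = P} P? =
      map′ (λ (i , h) → from i , h)
           (λ (x , h) → to x , subst P (sym (strictlyInverseʳ x)) h)
           (Fin.any? (P? ∘ from))

    any-Vec? : ∀ {A : Set} {ℓ} →
               (∀ {P : Pred A ℓ} → Decidable P → Dec (∃ P)) →
               ∀ {d} {P : Pred (Vec A d) ℓ} → Decidable P → Dec (∃ P)
    any-Vec? any-A? {zero}  P? = map′ (λ h → [] , h) (λ { ([] , h) → h }) (P? [])
    any-Vec? any-A? {suc d} P? =
      map′ (λ (x , xs , h) → x ∷ xs , h) (λ { (x ∷ xs , h) → x , xs , h })
           (any-A? λ x → any-Vec? any-A? λ xs → P? (x ∷ xs))

    all-from-any? : ∀ {A : Set} → (∀ {P : Pred A 0ℓ} → Decidable P → Dec (∃ P)) →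
                    ∀ {P : Pred A 0ℓ} → Decidable P → Dec (∀ x → P x)
    all-from-any? any-A? P? =
      map′ (λ ¬∃ x → decidable-stable (P? x) (λ ¬Px → ¬∃ (x , ¬Px)))
           (λ ∀P (x , ¬Px) → ¬Px (∀P x))
           (¬? (any-A? (¬? ∘ P?)))

    all-Carrier? : ∀ {P : Pred Carrier 0ℓ} → Decidable P → Dec (∀ x → P x)
    all-Carrier? = all-from-any? any-Carrier?

    IsLinear? : Decidable IsLinear
    IsLinear? M =
      map′ (λ (h , h′) → record { +-homo = h ; ·-homo = h′ })
           (λ l → IsLinear.+-homo l , IsLinear.·-homo l)
           ((all-Carrier? λ x → all-Carrier? λ y → M (x + y) ≟ (M x + M y)) ×-dec
            (Fin.all? λ c → all-Carrier? λ x → M (c · x) ≟ (c · M x)))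

    IsSubspace? : ∀ {U : Pred Carrier 0ℓ} → Decidable U → Dec (IsSubspace U)
    IsSubspace? U? =
      map′ (λ (h , h′ , h″) → record { 0#-closed = h ; +-closed = h′ ; ·-closed = h″ })
           (λ s → let open IsSubspace s in 0#-closed , +-closed , ·-closed)
           (U? 0# ×-dec
            (all-Carrier? λ x → all-Carrier? λ y → U? x →-dec (U? y →-dec U? (x + y))) ×-dec
            (Fin.all? λ c → all-Carrier? λ x → U? x →-dec U? (c · x)))

    IsBasis? : ∀ {U : Pred Carrier 0ℓ} → Decidable U →
               ∀ {d} (bs : Vec Carrier d) → Dec (IsBasis U bs)
    IsBasis? U? bs =
      map′ (λ (h , h′ , h″) → record { members = h ; independent = h′ ; spanning = h″ })
           (λ s → let open IsBasis s in members , independent , spanning)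
           (All.all? U? bs ×-dec
            (all-from-any? (any-Vec? Fin.any?) λ cs →
               (linearCombination cs bs ≟ 0#) →-dec All.all? (λ c → toℕ c ≟ᴺ 0) cs) ×-dec
            (all-Carrier? λ x → U? x →-dec
               any-Vec? Fin.any? λ cs → linearCombination cs bs ≟ x))

    Span : ∀ {d} → Vec Carrier d → Pred Carrier 0ℓ
    Span bs x = ∃[ cs ] linearCombination cs bs ≡ x

    Span? : ∀ {d} (bs : Vec Carrier d) → Decidable (Span bs)
    Span? bs x = any-Vec? Fin.any? λ cs → linearCombination cs bs ≟ x

    Span⊆ : ∀ {U d} {bs : Vec Carrier d} → IsSubspace U → All U bs →
            ∀ {x} → x ∈ Span bs → x ∈ U
    Span⊆ {U} sub all (cs , refl) = go cs all
      where
      open IsSubspace sub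
      go : ∀ {d} (cs : Vec (Fin p) d) {bs : Vec Carrier d} → All U bs → linearCombination cs bs ∈ U
      go []       []        = 0#-closed
      go (c ∷ cs) (h ∷ hs) = +-closed _ _ (·-closed c _ h) (go cs hs)

    Table : Set
    Table = Vec Carrier (p ^ n)

    apply : Table → Carrier → Carrier
    apply t x = lookup t (to x)

    table : (Carrier → Carrier) → Table
    table M = tabulate (M ∘ from)

    apply-table : ∀ M → apply (table M) ≗ M
    apply-table M x = trans (lookup∘tabulate (M ∘ from) (to x)) (cong M (strictlyInverseʳ x))

    Witness : (Carrier → Carrier) → (k : ℕ) → Table → Vec Carrier (n ∸ k) → Set
    Witness f k t bs =
      IsLinear (apply t) × IsSubspace (Span bs) × IsBasis (Span bs) bs ×
      ConstantOnCosets (Span bs) (λ x → f x - apply t x)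

    Witness? : ∀ f k t bs → Dec (Witness f k t bs)
    Witness? f k t bs =
      IsLinear? (apply t) ×-dec IsSubspace? (Span? bs) ×-dec IsBasis? (Span? bs) bs ×-dec
      (all-Carrier? λ x → all-Carrier? λ y →
         Span? bs (x - y) →-dec ((f x - apply t x) ≟ (f y - apply t y)))

    fromWitness : ∀ {f k} → k ≤ n × (∃[ t ] ∃[ bs ] Witness f k t bs) → CodimAtMost f k
    fromWitness (k≤n , t , bs , lin , sub , bas , const) = record
      { k≤n = k≤n ; M = apply t ; M-linear = lin ; U = Span bs ; U-subspace = sub
      ; U-dimension = bs , bas ; f-M-constant = const }

    toWitness : ∀ {f k} → CodimAtMost f k → k ≤ n × (∃[ t ] ∃[ bs ] Witness f k t bs)
    toWitness {f} {k} h = k≤n , table M , bs , lin , sub , bas , const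
      where
      open CodimAtMost h
      open IsLinear M-linear
      open IsSubspace U-subspace
      bs  = proj₁ U-dimension
      open IsBasis (proj₂ U-dimension)

      ⊆U : ∀ {x} → x ∈ Span bs → x ∈ U
      ⊆U = Span⊆ U-subspace members

      eq : apply (table M) ≗ M
      eq = apply-table M

      lin : IsLinear (apply (table M))
      lin = record
        { +-homo = λ x y → trans (eq (x + y)) (trans (+-homo x y) (sym (cong₂ _+_ (eq x) (eq y))))
        ; ·-homo = λ c x → trans (eq (c · x)) (trans (·-homo c x) (sym (cong (c ·_) (eq x)))) }

      sub : IsSubspace (Span bs)
      sub = record
        { 0#-closed = spanning _ 0#-closed
        ; +-closed  = λ x y hx hy → spanning _ (+-closed x y (⊆U hx) (⊆U hy))
        ; ·-closed  = λ c x hx → spanning _ (·-closed c x (⊆U hx)) }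

      bas : IsBasis (Span bs) bs
      bas = record
        { members     = All.map (spanning _) members
        ; independent = independent
        ; spanning    = λ _ hx → hx }

      const : ConstantOnCosets (Span bs) (λ x → f x - apply (table M) x)
      const x y hxy = trans (cong (λ z → f x - z) (eq x))
        (trans (f-M-constant x y (⊆U hxy)) (cong (λ z → f y - z) (sym (eq y))))

    CodimAtMost? : ∀ f k → Dec (CodimAtMost f k)
    CodimAtMost? f k = map′ fromWitness toWitness
      (k ≤? n ×-dec any-Vec? any-Carrier? λ t → any-Vec? any-Carrier? λ bs → Witness? f k t bs)

    ×ᴺ-zero : ∀ m → m ×ᴺ 0# ≡ 0#
    ×ᴺ-zero zero    = refl
    ×ᴺ-zero (suc m) = trans (+-identityˡ _) (×ᴺ-zero m)

    x-y≡0⇒x≡y : ∀ x y → x - y ≡ 0# → x ≡ y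
    x-y≡0⇒x≡y x y h =
      trans (sym (+-identityʳ x)) (trans (cong (x +_) (sym (-‿inverseˡ y)))
        (trans (sym (+-assoc x (- y) y)) (trans (cong (_+ y) h) (+-identityˡ y))))

    codimAtMost-n : ∀ f → CodimAtMost f n
    codimAtMost-n f = record
      { k≤n          = ≤-refl
      ; M            = λ _ → 0#
      ; M-linear     = record { +-homo = λ _ _ → sym (+-identityˡ 0#)
                              ; ·-homo = λ c _ → sym (×ᴺ-zero (toℕ c)) }
      ; U            = _≡ 0#
      ; U-subspace   = record { 0#-closed = refl
                              ; +-closed  = λ { _ _ refl refl → +-identityˡ 0# }
                              ; ·-closed  = λ { c _ refl → ×ᴺ-zero (toℕ c) } }
      ; U-dimension  = subst (HasDimension (_≡ 0#)) (sym (n∸n≡0 n))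
                         ([] , record { members     = []
                                      ; independent = λ { [] _ → [] }
                                      ; spanning    = λ { _ refl → [] , refl } })
      ; f-M-constant = λ x y h → cong (λ z → f z - 0#) (x-y≡0⇒x≡y x y h) }

    least : {P : ℕ → Set₁} → Decidable P → ∀ m → P m → ∃ (Least P)
    least P? m h with P? 0
    ... | yes h₀ = 0 , record { holds = h₀ ; minimal = λ _ _ → z≤n }
    least P? zero    h | no ¬h₀ = contradiction h ¬h₀
    least P? (suc m) h | no ¬h₀ with least (P? ∘ suc) m h
    ... | k , l = suc k , record
      { holds   = Least.holds l
      ; minimal = λ { zero h₀ → contradiction h₀ ¬h₀ ; (suc j) hj → s≤s (Least.minimal l j hj) } }

  abstract
    leastCodim : ∀ f → ∃[ k ] Least (CodimAtMost f) k
    leastCodim f = least (CodimAtMost? f) n (codimAtMost-n f)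

  codim : (Carrier → Carrier) → ℕ
  codim f = proj₁ (leastCodim f)

  AddInd : (Carrier → Carrier) → ℕ
  AddInd f = p ^ codim f

{-# OPTIONS --safe #-}
module Submission where

-- A composition of generators with r inversions agrees off a set O of at most r
-- points with a fractional linear map (a x + b) / (c x + d), a d ≠ b c.  If f - M is
-- constant on the cosets of U, then f (x + u) - f x = M u for all x and all u ∈ U.
-- At every x with x, x + u ∉ O, that is at q - 2 r or more points, this becomes
-- M u (c x + d) (c (x + u) + d) = (a d - b c) u, which for c, u ≠ 0 is a quadratic
-- equation in x; so c ≠ 0 and q > 2 r + 2 force U = 0.  If c = 0, then M u = (a / d) u,
-- hence f x - (a / d) x is constant on the cosets of U; were ∣U∣ > r, every coset would
-- leave O and f would be affine, of Carlitz rank 0.  So q > 2 r + 2 gives ∣U∣ ≤ r, i.e.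
-- AddInd f ≥ q / r, and otherwise (q - 2 r) / 2 ≤ 1 ≤ AddInd f.

open import Defs

import Algebra.Properties.CommutativeMonoid.Mult as CommutativeMonoidMult
import Algebra.Properties.CommutativeMonoid.Sum as CommutativeMonoidSum
import Algebra.Properties.Ring as RingProperties
import Algebra.Properties.Semiring.Mult as SemiringMult
import Algebra.Solver.Ring.NaturalCoefficients.Default as SemiringSolver
open import Algebra.Bundles using (CommutativeRing)
open import Data.Fin.Base using (Fin; zero; toℕ; fromℕ<; quotient; remainder; combine)
open import Data.Fin.Permutation using (Permutation′; permutation)
import Data.Fin.Properties as Fin
import Data.Integer.Base as ℤ
import Data.Integer.Properties as ℤ
open import Data.List.Base using (List; []; _∷_; _++_; length; map)
import Data.List.Properties as List
import Data.List.Membership.DecPropositional as DecMembership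
open import Data.List.Membership.Propositional using (_∈_; _∉_)
open import Data.List.Membership.Propositional.Properties using (∈-++⁺ˡ; ∈-++⁺ʳ; ∈-map⁺)
import Data.List.Membership.Setoid.Properties as SetoidMembership
open import Data.List.Relation.Unary.Any using (here; there; index)
import Data.Nat.Base as ℕ
import Data.Nat.Properties as ℕ
open import Data.Nat.Base using (ℕ; zero; suc; _^_)
open import Data.Product.Base using (_×_; ∃-syntax; _,_; proj₁; proj₂)
import Data.Rational.Properties as ℚ
import Data.Rational.Unnormalised.Base as ℚᵘ
import Data.Rational.Unnormalised.Properties as ℚᵘ
open import Data.Sum.Base using (_⊎_; inj₁; inj₂; [_,_]′)
open import Data.Vec.Base using (Vec; []; _∷_)
import Data.Vec.Properties as Vec
open import Data.Vec.Relation.Unary.All using (All; []; _∷_)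
open import Function.Base using (id; _∘_)
open import Function.Bundles using (Inverse)
open import Function.Definitions using (Injective)
open import Function.Properties.Inverse using (↔⇒↣)
open import Relation.Binary.Definitions using (DecidableEquality)
open import Relation.Binary.PropositionalEquality
  using (_≡_; _≢_; _≗_; refl; sym; trans; cong; cong₂; subst; setoid; module ≡-Reasoning)
open import Relation.Nullary.Decidable using (yes; no; via-injection)
open import Relation.Nullary.Negation using (¬_; contradiction)

-- Pigeonhole principle and base-`p` digit vectors

-- If every `g i` occurred in `xs`, its position there would determine `i`, giving an injection of
-- `Fin N` into the smaller set `Fin (length xs)`.
avoid : ∀ {A : Set} → DecidableEquality A →
        ∀ {N} (g : Fin N → A) → Injective _≡_ _≡_ g →
        ∀ xs → length xs ℕ.< N → ∃[ i ] g i ∉ xs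
avoid {A} _≟_ {N} g g-inj xs xs<N =
  Fin.¬∀⟶∃¬ N _ (λ i → g i ∈? xs) λ g∈xs →
    Fin.<⇒notInjective {f = index ∘ g∈xs} xs<N
      (λ eq → g-inj (SetoidMembership.index-injective (setoid A) (g∈xs _) (g∈xs _) eq))
  where open DecMembership _≟_ using (_∈?_)

-- Base-`p` expansion, leading digit first. It numbers the coefficient vectors, so that the elements
-- of a subspace with a basis of `m` vectors can be counted.
digits : ∀ {p} m → Fin (p ^ m) → Vec (Fin p) m
digits         zero    _ = []
digits {p = p} (suc m) i = quotient {p} (p ^ m) i ∷ digits m (remainder {p} (p ^ m) i)

digits-injective : ∀ {p} m → Injective _≡_ _≡_ (digits {p} m)
digits-injective         zero    {zero} {zero} _  = refl
digits-injective {p = p} (suc m) {i}    {j}    eq =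
  trans (sym (Fin.combine-remQuot {p} (p ^ m) i))
    (trans (cong₂ combine (Vec.∷-injectiveˡ eq) (digits-injective m (Vec.∷-injectiveʳ eq)))
      (Fin.combine-remQuot {p} (p ^ m) j))

-- Field arithmetic, the characteristic and a quadratic equation

module FieldProperties {q : ℕ} (K : FiniteField q) where
  open FiniteField K public
  open CommutativeRing commutativeRing public
    using (*-assoc; *-comm; *-identityˡ; zeroˡ; zeroʳ; -‿inverseʳ; +-comm)
  open CommutativeRing commutativeRing
    using (ring; semiring; commutativeSemiring; +-commutativeMonoid)
  open RingProperties ring public using (+-cancelˡ; +-cancelʳ)
  open SemiringSolver commutativeSemiring public using (solve; _:+_; _:*_; _:=_)
  open CommutativeMonoidSum +-commutativeMonoid
    using (sum; sum-permute; sum-cong-≗; ∑-distrib-+; sum-replicate)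
  open CommutativeMonoidMult +-commutativeMonoid public using (×-homo-+; ×-homo-1)
    renaming (_×_ to _×ᴺ_)
  open SemiringMult semiring using (×1-homo-*; ×-assoc-*)
  open Inverse enumeration using (to; from; strictlyInverseˡ; strictlyInverseʳ)
  open ≡-Reasoning

  _≟_ : DecidableEquality Carrier
  _≟_ = via-injection (↔⇒↣ enumeration) Fin._≟_

  from-injective : Injective _≡_ _≡_ from
  from-injective {i} {j} eq =
    trans (sym (strictlyInverseˡ i)) (trans (cong to eq) (strictlyInverseˡ j))

  avoid-list : ∀ xs → length xs ℕ.< q → ∃[ x ] x ∉ xs
  avoid-list xs xs<q = let i , ∉xs = avoid _≟_ from from-injective xs xs<q in from i , ∉xs

  x+y-y≡x : ∀ x y → (x + y) - y ≡ x
  x+y-y≡x x y = trans (+-assoc x y (- y)) (trans (cong (x +_) (-‿inverseʳ y)) (+-identityʳ x))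

  x-y+y≡x : ∀ x y → (x - y) + y ≡ x
  x-y+y≡x x y = trans (+-assoc x (- y) y) (trans (cong (x +_) (-‿inverseˡ y)) (+-identityʳ x))

  *-cancelˡ-≢0 : ∀ {x y z} → x ≢ 0# → x * y ≡ x * z → y ≡ z
  *-cancelˡ-≢0 {x} {y} {z} x≢0 eq = begin
    y                ≡⟨ inv y ⟨
    x ⁻¹ * (x * y)   ≡⟨ cong (x ⁻¹ *_) eq ⟩
    x ⁻¹ * (x * z)   ≡⟨ inv z ⟩
    z                ∎
    where
    inv : ∀ w → x ⁻¹ * (x * w) ≡ w
    inv w = begin
      x ⁻¹ * (x * w)   ≡⟨ solve 3 (λ x y z → x :* (y :* z) := (y :* x) :* z) refl (x ⁻¹) x w ⟩
      (x * x ⁻¹) * w   ≡⟨ cong (_* w) (⁻¹-inverse x x≢0) ⟩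
      1# * w           ≡⟨ *-identityˡ w ⟩
      w                ∎

  x*y≡0⇒x≡0⊎y≡0 : ∀ x y → x * y ≡ 0# → x ≡ 0# ⊎ y ≡ 0#
  x*y≡0⇒x≡0⊎y≡0 x y eq with x ≟ 0#
  ... | yes x≡0 = inj₁ x≡0
  ... | no  x≢0 = inj₂ (*-cancelˡ-≢0 x≢0 (trans eq (sym (zeroʳ x))))

  -- Translation by x permutes the field, so it does not change the sum of all elements.
  q×x≡0 : ∀ x → q ×ᴺ x ≡ 0#
  q×x≡0 x = +-cancelˡ (sum from) _ _ (begin
    sum from + q ×ᴺ x               ≡⟨ cong (sum from +_) (sum-replicate q) ⟨
    sum from + sum {q} (λ _ → x)    ≡⟨ ∑-distrib-+ from (λ _ → x) ⟨
    sum (λ i → from i + x)          ≡⟨ sum-cong-≗ (λ i → strictlyInverseʳ (from i + x)) ⟨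
    sum (λ i → from (to (from i + x))) ≡⟨ sum-permute from translation ⟨
    sum from                        ≡⟨ +-identityʳ _ ⟨
    sum from + 0#                   ∎)
    where
    translation : Permutation′ q
    translation = permutation (λ i → to (from i + x)) (λ i → to (from i - x))
      (λ i → trans (cong (λ y → to (y + x)) (strictlyInverseʳ _))
               (trans (cong to (x-y+y≡x (from i) x)) (strictlyInverseˡ i)))
      (λ i → trans (cong (λ y → to (y - x)) (strictlyInverseʳ _))
               (trans (cong to (x+y-y≡x (from i) x)) (strictlyInverseˡ i)))

  -- A multiple of `1#` by a product of numbers is the product of the multiples, and a field has no
  -- zero divisors. Splitting off one factor `p` at a time ends at `1# ≡ 0#`, which is impossible.
  p^k×1≡0⇒p×1≡0 : ∀ p k → (p ^ k) ×ᴺ 1# ≡ 0# → p ×ᴺ 1# ≡ 0#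
  p^k×1≡0⇒p×1≡0 p zero    eq = contradiction (trans (sym eq) (×-homo-1 1#)) 0≢1
  p^k×1≡0⇒p×1≡0 p (suc k) eq =
    [ id , p^k×1≡0⇒p×1≡0 p k ]′
      (x*y≡0⇒x≡0⊎y≡0 _ _ (trans (sym (×1-homo-* p (p ^ k))) eq))

  -- This lets residues modulo `p` act as scalars, so that differences of coefficients can be
  -- reduced modulo `p`.
  p×x≡0 : ∀ {p} k → q ≡ p ^ k → ∀ x → p ×ᴺ x ≡ 0#
  p×x≡0 {p} k q≡p^k x = begin
    p ×ᴺ x          ≡⟨ cong (p ×ᴺ_) (*-identityˡ x) ⟨
    p ×ᴺ (1# * x)   ≡⟨ ×-assoc-* p 1# x ⟨
    (p ×ᴺ 1#) * x   ≡⟨ cong (_* x) (p^k×1≡0⇒p×1≡0 p k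
                         (subst (λ m → m ×ᴺ 1# ≡ 0#) q≡p^k (q×x≡0 1#))) ⟩
    0# * x          ≡⟨ zeroˡ x ⟩
    0#              ∎

  -- The quadratic t ↦ t (t + e) takes each value at most twice, at t and at - (t + e).
  t[t+e]≡s[s+e]⇒t≡s⊎t+[s+e]≡0 : ∀ e t s → t * (t + e) ≡ s * (s + e) → t ≡ s ⊎ t + (s + e) ≡ 0#
  t[t+e]≡s[s+e]⇒t≡s⊎t+[s+e]≡0 e t s eq with x*y≡0⇒x≡0⊎y≡0 (t - s) (t + (s + e)) product≡0
    where
    -- Replacing `t` by `δ + s` turns the factorisation into an identity without subtraction, which
    -- the semiring solver can prove.
    δ = t - s
    product≡0 : δ * (t + (s + e)) ≡ 0#
    product≡0 = +-cancelˡ (s * (s + e)) _ _ (begin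
      s * (s + e) + δ * (t + (s + e))        ≡⟨ cong (λ y → s * (s + e) + δ * (y + (s + e))) (x-y+y≡x t s) ⟨
      s * (s + e) + δ * ((δ + s) + (s + e))  ≡⟨ solve 3 (λ δ s e →
        (s :* (s :+ e)) :+ (δ :* ((δ :+ s) :+ (s :+ e))) := (δ :+ s) :* ((δ :+ s) :+ e)) refl δ s e ⟩
      (δ + s) * ((δ + s) + e)                ≡⟨ cong (λ y → y * (y + e)) (x-y+y≡x t s) ⟩
      t * (t + e)                            ≡⟨ eq ⟩
      s * (s + e)                            ≡⟨ +-identityʳ _ ⟨
      s * (s + e) + 0#                       ∎)
  ... | inj₁ δ≡0 = inj₁ (trans (sym (x-y+y≡x t s)) (trans (cong (_+ s) δ≡0) (+-identityˡ s)))
  ... | inj₂ z   = inj₂ z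

-- Carlitz rank and fractional linear maps

module FractionalLinear {q : ℕ} (K : FiniteField q) where
  open FieldProperties K
  open CarlitzRank K
  open ≡-Reasoning

  -- With the denominator cleared, `value` involves no division. A pole off `O` cannot occur: there
  -- `c * x + d` and `a * x + b` would both vanish, contradicting `ad≢bc`.
  record FractionalLinearOff (O : List Carrier) (f : Carrier → Carrier) : Set where
    field
      a b c d : Carrier
      ad≢bc   : a * d ≢ b * c
      value   : ∀ x → x ∉ O → f x * (c * x + d) ≡ a * x + b

  -- The coefficient matrix is multiplied on the left by a triangular one of determinant `α`. In the
  -- new determinant the terms `β * (c * d)` cancel, and what remains is `α` times the old one.
  affine-∘ : ∀ {O f} α β → α ≢ 0# → FractionalLinearOff O f →
             FractionalLinearOff O (λ x → α * f x + β)
  affine-∘ {f = f} α β α≢0 F = record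
    { a = α * a + β * c ; b = α * b + β * d ; c = c ; d = d
    ; ad≢bc = λ eq → ad≢bc (*-cancelˡ-≢0 α≢0 (+-cancelʳ (β * (c * d)) _ _ (begin
        α * (a * d) + β * (c * d)   ≡⟨ solve 5 (λ α β a c d →
          (α :* (a :* d)) :+ (β :* (c :* d)) := ((α :* a) :+ (β :* c)) :* d) refl α β a c d ⟩
        (α * a + β * c) * d         ≡⟨ eq ⟩
        (α * b + β * d) * c         ≡⟨ solve 5 (λ α β b c d →
          ((α :* b) :+ (β :* d)) :* c := (α :* (b :* c)) :+ (β :* (c :* d))) refl α β b c d ⟩
        α * (b * c) + β * (c * d)   ∎)))
    ; value = λ x x∉O → begin
        (α * f x + β) * (c * x + d)            ≡⟨ solve 4 (λ α β y z →
          ((α :* y) :+ β) :* z := (α :* (y :* z)) :+ (β :* z)) refl α β (f x) (c * x + d) ⟩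
        α * (f x * (c * x + d)) + β * (c * x + d) ≡⟨ cong (λ y → α * y + β * (c * x + d)) (value x x∉O) ⟩
        α * (a * x + b) + β * (c * x + d)      ≡⟨ solve 7 (λ α β a b c d x →
          (α :* ((a :* x) :+ b)) :+ (β :* ((c :* x) :+ d)) :=
          (((α :* a) :+ (β :* c)) :* x) :+ ((α :* b) :+ (β :* d))) refl α β a b c d x ⟩
        (α * a + β * c) * x + (α * b + β * d)  ∎ }
    where open FractionalLinearOff F

  -- The new exceptional point is the zero of a x + b.  For a = 0 there is none,
  -- and the list is extended by the junk value 0.
  inversion-∘ : ∀ {O f} → FractionalLinearOff O f →
                ∃[ z ] FractionalLinearOff (z ∷ O) (λ x → f x ⁻¹)
  inversion-∘ {O} {f} F = z , record
    { a = c ; b = d ; c = a ; d = b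
    ; ad≢bc = λ eq → ad≢bc (trans (*-comm a d) (trans (sym eq) (*-comm c b)))
    ; value = λ x x∉z∷O →
        let ax+b≢0 = numerator≢0 x (x∉z∷O ∘ here)
            fx     = value x (x∉z∷O ∘ there)
            fx≢0 : f x ≢ 0#
            fx≢0 fx≡0 = ax+b≢0 (trans (sym fx) (trans (cong (_* (c * x + d)) fx≡0) (zeroˡ _)))
        in begin
          f x ⁻¹ * (a * x + b)           ≡⟨ cong (f x ⁻¹ *_) fx ⟨
          f x ⁻¹ * (f x * (c * x + d))   ≡⟨ solve 3 (λ x y z → x :* (y :* z) := (y :* x) :* z) refl (f x ⁻¹) (f x) (c * x + d) ⟩
          (f x * f x ⁻¹) * (c * x + d)   ≡⟨ cong (_* (c * x + d)) (⁻¹-inverse (f x) fx≢0) ⟩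
          1# * (c * x + d)               ≡⟨ *-identityˡ _ ⟩
          c * x + d                      ∎ }
    where
    open FractionalLinearOff F
    z = a ⁻¹ * - b
    numerator≢0 : ∀ x → x ≢ z → a * x + b ≢ 0#
    numerator≢0 x x≢z ax+b≡0 with a ≟ 0#
    ... | yes a≡0 = ad≢bc (begin
      a * d   ≡⟨ cong (_* d) a≡0 ⟩
      0# * d  ≡⟨ zeroˡ d ⟩
      0#      ≡⟨ zeroˡ c ⟨
      0# * c  ≡⟨ cong (_* c) b≡0 ⟨
      b * c   ∎)
      where
      b≡0 : b ≡ 0#
      b≡0 = begin
        b           ≡⟨ +-identityˡ b ⟨
        0# + b      ≡⟨ cong (_+ b) (trans (cong (_* x) a≡0) (zeroˡ x)) ⟨
        a * x + b   ≡⟨ ax+b≡0 ⟩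
        0#          ∎
    ... | no a≢0 = x≢z (*-cancelˡ-≢0 a≢0 (+-cancelʳ b _ _ (begin
      a * x + b             ≡⟨ ax+b≡0 ⟩
      0#                    ≡⟨ -‿inverseˡ b ⟨
      - b + b               ≡⟨ cong (_+ b) (*-identityˡ (- b)) ⟨
      1# * - b + b          ≡⟨ cong (λ y → y * - b + b) (⁻¹-inverse a a≢0) ⟨
      (a * a ⁻¹) * - b + b  ≡⟨ cong (_+ b) (*-assoc a (a ⁻¹) (- b)) ⟩
      a * z + b             ∎)))

  -- The length is exact, not merely bounded: each inversion adds one entry, possibly a junk one,
  -- and affine maps add none.
  compose-fractionalLinear : ∀ gs → ∃[ O ] length O ≡ inversions gs × FractionalLinearOff O (compose gs)
  compose-fractionalLinear [] = [] , refl , record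
    { a = 1# ; b = 0# ; c = 0# ; d = 1#
    ; ad≢bc = λ eq → 0≢1 (sym (trans (sym (*-identityˡ 1#)) (trans eq (zeroˡ 0#))))
    ; value = λ x _ → begin
        x * (0# * x + 1#)  ≡⟨ cong (λ y → x * (y + 1#)) (zeroˡ x) ⟩
        x * (0# + 1#)      ≡⟨ cong (x *_) (+-identityˡ 1#) ⟩
        x * 1#             ≡⟨ *-comm x 1# ⟩
        1# * x             ≡⟨ +-identityʳ _ ⟨
        1# * x + 0#        ∎ }
  compose-fractionalLinear (inversion ∷ gs) =
    let O , eq , F = compose-fractionalLinear gs
        z , F′     = inversion-∘ F
    in z ∷ O , cong suc eq , F′
  compose-fractionalLinear (affine α β α≢0 ∷ gs) =
    let O , eq , F = compose-fractionalLinear gs in O , eq , affine-∘ α β α≢0 F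

  carlitz-fractionalLinear : ∀ {f r} → HasCarlitzRank f r → ∃[ O ] length O ≡ r × FractionalLinearOff O f
  carlitz-fractionalLinear {f} h =
    let gs , gs≗f , inv≡r = attained
        O , eq , F        = compose-fractionalLinear gs
        open FractionalLinearOff F
    in O , trans eq inv≡r , record
         { a = a ; b = b ; c = c ; d = d ; ad≢bc = ad≢bc
         ; value = λ x x∉O → trans (cong (_* (c * x + d)) (sym (gs≗f x))) (value x x∉O) }
    where open HasCarlitzRank h

  -- A single affine generator uses no inversion, so minimality would give `r ≤ 0`.
  carlitzRank>0⇒¬affine : ∀ {f r} → HasCarlitzRank f r → 0 ℕ.< r →
                          ∀ α β → α ≢ 0# → ¬ (∀ x → f x ≡ α * x + β)
  carlitzRank>0⇒¬affine h 0<r α β α≢0 f≗ =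
    ℕ.<⇒≱ 0<r (HasCarlitzRank.minimal h (affine α β α≢0 ∷ []) (sym ∘ f≗))

-- Constant differences of maps that are fractional linear off `O`

module Translation {q : ℕ} (K : FiniteField q) {O : List (FiniteField.Carrier K)}
                   {f : FiniteField.Carrier K → FiniteField.Carrier K}
                   (F : FractionalLinear.FractionalLinearOff K O f) where
  open FieldProperties K
  open FractionalLinear.FractionalLinearOff F
  open ≡-Reasoning

  -- Off this list both `x` and `x + u` avoid `O`.
  exceptions : Carrier → List Carrier
  exceptions u = O ++ map (_- u) O

  length-exceptions : ∀ u → length (exceptions u) ≡ 2 ℕ.* length O
  length-exceptions u = trans (List.length-++ O)
    (cong (length O ℕ.+_) (trans (List.length-map (_- u) O) (sym (ℕ.+-identityʳ (length O)))))

  ∉exceptions⇒∉O : ∀ {u x} → x ∉ exceptions u → x ∉ O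
  ∉exceptions⇒∉O x∉ x∈O = x∉ (∈-++⁺ˡ x∈O)

  ∉exceptions⇒+∉O : ∀ {u x} → x ∉ exceptions u → x + u ∉ O
  ∉exceptions⇒+∉O {u} {x} x∉ x+u∈O =
    x∉ (∈-++⁺ʳ O (subst (_∈ map (_- u) O) (x+y-y≡x x u) (∈-map⁺ (_- u) x+u∈O)))

  -- The equation m = f (x + u) - f x with denominators cleared and no subtraction.
  difference : ∀ {u m} → (∀ x → f (x + u) ≡ m + f x) → ∀ x → x ∉ exceptions u →
               m * ((c * x + d) * (c * x + d + c * u)) + b * c * u ≡ a * d * u
  difference {u} {m} f[x+u]≡m+fx x x∉ = +-cancelʳ (f x * D * (D + c * u)) _ _ (begin
    m * (D * (D + c * u)) + b * c * u + f x * D * (D + c * u)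
      ≡⟨ solve 5 (λ m y D D′ r → ((m :* (D :* D′)) :+ r) :+ ((y :* D) :* D′) :=
           (((m :+ y) :* D′) :* D) :+ r) refl m (f x) D (D + c * u) (b * c * u) ⟩
    (m + f x) * (D + c * u) * D + b * c * u
      ≡⟨ cong₂ (λ y D′ → y * D′ * D + b * c * u) (sym (f[x+u]≡m+fx x)) D+cu≡ ⟩
    f (x + u) * (c * (x + u) + d) * D + b * c * u
      ≡⟨ cong (λ y → y * D + b * c * u) (value (x + u) (∉exceptions⇒+∉O x∉)) ⟩
    (a * (x + u) + b) * D + b * c * u
      ≡⟨ solve 6 (λ a b c d x u →
           (((a :* (x :+ u)) :+ b) :* ((c :* x) :+ d)) :+ ((b :* c) :* u) :=
           ((a :* d) :* u) :+ (((a :* x) :+ b) :* (((c :* x) :+ d) :+ (c :* u)))) refl a b c d x u ⟩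
    a * d * u + (a * x + b) * (D + c * u)
      ≡⟨ cong (λ y → a * d * u + y * (D + c * u)) (value x (∉exceptions⇒∉O x∉)) ⟨
    a * d * u + f x * D * (D + c * u)  ∎)
    where
    D = c * x + d
    D+cu≡ : D + c * u ≡ c * (x + u) + d
    D+cu≡ = solve 4 (λ c d x u → ((c :* x) :+ d) :+ (c :* u) := (c :* (x :+ u)) :+ d) refl c d x u

  -- For c ≠ 0, a third x outside the exceptional points would be a third root of
  -- the quadratic equation given by difference.
  c≢0⇒no-constant-difference : c ≢ 0# → 2 ℕ.+ 2 ℕ.* length O ℕ.< q →
    ∀ {u m} → u ≢ 0# → ¬ (∀ x → f (x + u) ≡ m + f x)
  c≢0⇒no-constant-difference c≢0 O<q {u} {m} u≢0 const = [ different-values , other-root ]′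
    -- The equations `difference` at `y` and at `x` have the same right-hand side. Cancelling
    -- `b * c * u` and `m` leaves the same quadratic value at `c * y + d` and at `c * x + d`.
    (t[t+e]≡s[s+e]⇒t≡s⊎t+[s+e]≡0 (c * u) (c * y + d) (c * x + d)
      (*-cancelˡ-≢0 m≢0 (+-cancelʳ (b * c * u) _ _
        (trans (difference const y (y∉ ∘ there ∘ there)) (sym (difference const x x∉))))))
    where
    exceptions<q : 2 ℕ.+ length (exceptions u) ℕ.< q
    exceptions<q = subst (λ l → 2 ℕ.+ l ℕ.< q) (sym (length-exceptions u)) O<q

    first : ∃[ x ] x ∉ exceptions u
    first = avoid-list (exceptions u) (ℕ.<-trans (ℕ.m<n+m _ {2} ℕ.z<s) exceptions<q)

    x  = proj₁ first
    x∉ = proj₂ first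
    s′ = c * x + d + c * u
    -- The second root of the quadratic equation: `c * x′ + d` equals `- s′`.
    x′ = c ⁻¹ * (- s′ - d)

    -- Avoiding the two roots `x` and `x′` as well accounts for the summand 2 in the bound on `q`.
    second : ∃[ y ] y ∉ x ∷ x′ ∷ exceptions u
    second = avoid-list (x ∷ x′ ∷ exceptions u) exceptions<q

    y  = proj₁ second
    y∉ = proj₂ second

    -- For `m ≡ 0#` the quadratic term disappears from `difference`, and cancelling `u` contradicts
    -- `ad≢bc`.
    m≢0 : m ≢ 0#
    m≢0 m≡0 = ad≢bc (*-cancelˡ-≢0 u≢0 (begin
      u * (a * d)                                           ≡⟨ *-comm u (a * d) ⟩
      a * d * u                                             ≡⟨ difference const x x∉ ⟨
      m * ((c * x + d) * (c * x + d + c * u)) + b * c * u   ≡⟨ cong (λ z → z * ((c * x + d) * (c * x + d + c * u)) + b * c * u) m≡0 ⟩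
      0# * ((c * x + d) * (c * x + d + c * u)) + b * c * u  ≡⟨ cong (_+ b * c * u) (zeroˡ _) ⟩
      0# + b * c * u                                        ≡⟨ +-identityˡ _ ⟩
      b * c * u                                             ≡⟨ *-comm (b * c) u ⟩
      u * (b * c)                                           ∎))

    different-values : c * y + d ≢ c * x + d
    different-values eq = y∉ (here (*-cancelˡ-≢0 c≢0 (+-cancelʳ d _ _ eq)))

    other-root : c * y + d + s′ ≢ 0#
    other-root eq = y∉ (there (here (*-cancelˡ-≢0 c≢0 (+-cancelʳ d _ _ (+-cancelʳ s′ _ _ (begin
      c * y + d + s′                       ≡⟨ eq ⟩
      0#                                   ≡⟨ -‿inverseˡ s′ ⟨
      - s′ + s′                            ≡⟨ cong (_+ s′) (x-y+y≡x (- s′) d) ⟨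
      - s′ - d + d + s′                    ≡⟨ cong (λ z → z + d + s′) (*-identityˡ (- s′ - d)) ⟨
      1# * (- s′ - d) + d + s′             ≡⟨ cong (λ z → z * (- s′ - d) + d + s′) (⁻¹-inverse c c≢0) ⟨
      (c * c ⁻¹) * (- s′ - d) + d + s′     ≡⟨ cong (λ z → z + d + s′) (*-assoc c (c ⁻¹) (- s′ - d)) ⟩
      c * x′ + d + s′                      ∎))))))

  module Affine (c≡0 : c ≡ 0#) where

    α β : Carrier
    α = a * d ⁻¹
    β = b * d ⁻¹

    bc≡0 : b * c ≡ 0#
    bc≡0 = trans (cong (b *_) c≡0) (zeroʳ b)

    d≢0 : d ≢ 0#
    d≢0 d≡0 = ad≢bc (trans (cong (a *_) d≡0) (trans (zeroʳ a) (sym bc≡0)))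

    y*d⁻¹*d≡y : ∀ y → d * (y * d ⁻¹) ≡ y
    y*d⁻¹*d≡y y = begin
      d * (y * d ⁻¹)   ≡⟨ solve 3 (λ d y i → d :* (y :* i) := (d :* i) :* y) refl d y (d ⁻¹) ⟩
      (d * d ⁻¹) * y   ≡⟨ cong (_* y) (⁻¹-inverse d d≢0) ⟩
      1# * y           ≡⟨ *-identityˡ y ⟩
      y                ∎

    α≢0 : α ≢ 0#
    α≢0 α≡0 = ad≢bc (begin
      a * d         ≡⟨ cong (_* d) (y*d⁻¹*d≡y a) ⟨
      d * α * d     ≡⟨ cong (λ z → d * z * d) α≡0 ⟩
      d * 0# * d    ≡⟨ cong (_* d) (zeroʳ d) ⟩
      0# * d        ≡⟨ zeroˡ d ⟩
      0#            ≡⟨ bc≡0 ⟨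
      b * c         ∎)

    f≡αx+β : ∀ x → x ∉ O → f x ≡ α * x + β
    f≡αx+β x x∉O = *-cancelˡ-≢0 d≢0 (begin
      d * f x                  ≡⟨ *-comm d (f x) ⟩
      f x * d                  ≡⟨ cong (f x *_) (+-identityˡ d) ⟨
      f x * (0# + d)           ≡⟨ cong (λ z → f x * (z + d)) (trans (cong (_* x) c≡0) (zeroˡ x)) ⟨
      f x * (c * x + d)        ≡⟨ value x x∉O ⟩
      a * x + b                ≡⟨ cong₂ (λ y z → y * x + z) (y*d⁻¹*d≡y a) (y*d⁻¹*d≡y b) ⟨
      d * α * x + d * β        ≡⟨ solve 4 (λ d α β x →
        ((d :* α) :* x) :+ (d :* β) := d :* ((α :* x) :+ β)) refl d α β x ⟩
      d * (α * x + β)          ∎)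

    -- As `m` does not depend on `x`, it can be read off at a single point where both `x` and
    -- `x + u` avoid `O`. The bound on `q` provides such a point.
    constant-difference≡αu : 2 ℕ.* length O ℕ.< q →
      ∀ {u m} → (∀ x → f (x + u) ≡ m + f x) → m ≡ α * u
    constant-difference≡αu O<q {u} {m} const =
      let x , x∉ = avoid-list (exceptions u) (subst (ℕ._< q) (sym (length-exceptions u)) O<q) in
      +-cancelʳ (α * x + β) _ _ (begin
        m + (α * x + β)        ≡⟨ cong (m +_) (f≡αx+β x (∉exceptions⇒∉O x∉)) ⟨
        m + f x                ≡⟨ const x ⟨
        f (x + u)              ≡⟨ f≡αx+β (x + u) (∉exceptions⇒+∉O x∉) ⟩
        α * (x + u) + β        ≡⟨ solve 4 (λ α β x u →
          (α :* (x :+ u)) :+ β := (α :* u) :+ ((α :* x) :+ β)) refl α β x u ⟩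
        α * u + (α * x + β)    ∎)

    -- The affine formula is carried back from `x + u` to `x`, which may itself lie in `O`: passing
    -- from `x` to `x + u` adds the same amount `m` to both sides.
    affine-at-translate : 2 ℕ.* length O ℕ.< q →
      ∀ {u m} → (∀ x → f (x + u) ≡ m + f x) → ∀ x → x + u ∉ O → f x ≡ α * x + β
    affine-at-translate O<q {u} {m} const x x+u∉O = +-cancelˡ m _ _ (begin
      m + f x                ≡⟨ const x ⟨
      f (x + u)              ≡⟨ f≡αx+β (x + u) x+u∉O ⟩
      α * (x + u) + β        ≡⟨ solve 4 (λ α β x u →
        (α :* (x :+ u)) :+ β := (α :* u) :+ ((α :* x) :+ β)) refl α β x u ⟩
      α * u + (α * x + β)    ≡⟨ cong (_+ (α * x + β)) (constant-difference≡αu O<q const) ⟨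
      m + (α * x + β)        ∎)

-- Counting subspaces and bounding the codimension

module Codimension (p n : ℕ) (K : FiniteField (p ^ n)) where
  open FieldProperties K
  open FractionalLinear K
  open CarlitzRank K using (HasCarlitzRank)
  open AdditiveIndex p n K
  open ≡-Reasoning

  -- A representative of c - c′ modulo p.
  digit-difference : ∀ (c c′ : Fin p) →
    ∃[ d ] (∀ x → d · x + c′ · x ≡ c · x) × (toℕ d ≡ 0 → c ≡ c′)
  digit-difference c c′ with toℕ c′ ℕ.≤? toℕ c
  ... | yes c′≤c = fromℕ< c∸c′<p
      , (λ x → begin
          fromℕ< c∸c′<p · x + c′ · x            ≡⟨ cong (λ m → m ×ᴺ x + c′ · x) (Fin.toℕ-fromℕ< c∸c′<p) ⟩
          (toℕ c ℕ.∸ toℕ c′) ×ᴺ x + c′ · x      ≡⟨ ×-homo-+ x (toℕ c ℕ.∸ toℕ c′) (toℕ c′) ⟨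
          (toℕ c ℕ.∸ toℕ c′ ℕ.+ toℕ c′) ×ᴺ x    ≡⟨ cong (_×ᴺ x) (ℕ.m∸n+n≡m c′≤c) ⟩
          c · x                                 ∎)
      , λ d≡0 → Fin.toℕ-injective (ℕ.≤-antisym
          (ℕ.m∸n≡0⇒m≤n (trans (sym (Fin.toℕ-fromℕ< c∸c′<p)) d≡0)) c′≤c)
    where
    c∸c′<p : toℕ c ℕ.∸ toℕ c′ ℕ.< p
    c∸c′<p = ℕ.≤-<-trans (ℕ.m∸n≤m (toℕ c) (toℕ c′)) (Fin.toℕ<n c)
  ... | no c′≰c = fromℕ< d<p
      , (λ x → begin
          fromℕ< d<p · x + c′ · x                     ≡⟨ cong (λ m → m ×ᴺ x + c′ · x) (Fin.toℕ-fromℕ< d<p) ⟩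
          (toℕ c ℕ.+ (p ℕ.∸ toℕ c′)) ×ᴺ x + c′ · x    ≡⟨ ×-homo-+ x (toℕ c ℕ.+ (p ℕ.∸ toℕ c′)) (toℕ c′) ⟨
          (toℕ c ℕ.+ (p ℕ.∸ toℕ c′) ℕ.+ toℕ c′) ×ᴺ x  ≡⟨ cong (_×ᴺ x) (trans (ℕ.+-assoc (toℕ c) _ _) (cong (toℕ c ℕ.+_) p∸c′+c′≡p)) ⟩
          (toℕ c ℕ.+ p) ×ᴺ x                          ≡⟨ ×-homo-+ x (toℕ c) p ⟩
          c · x + p ×ᴺ x                              ≡⟨ cong (c · x +_) (p×x≡0 n refl x) ⟩
          c · x + 0#                                  ≡⟨ +-identityʳ _ ⟩
          c · x                                       ∎)
      -- This representative is at least `p - c′`, which is positive, so it is never 0.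
      , λ d≡0 → contradiction
          (ℕ.m∸n≡0⇒m≤n (ℕ.m+n≡0⇒n≡0 (toℕ c) (trans (sym (Fin.toℕ-fromℕ< d<p)) d≡0)))
          (ℕ.<⇒≱ (Fin.toℕ<n c′))
    where
    p∸c′+c′≡p : p ℕ.∸ toℕ c′ ℕ.+ toℕ c′ ≡ p
    p∸c′+c′≡p = ℕ.m∸n+n≡m (ℕ.<⇒≤ (Fin.toℕ<n c′))

    d<p : toℕ c ℕ.+ (p ℕ.∸ toℕ c′) ℕ.< p
    d<p = subst (toℕ c ℕ.+ (p ℕ.∸ toℕ c′) ℕ.<_)
      (trans (ℕ.+-comm (toℕ c′) _) p∸c′+c′≡p)
      (ℕ.+-monoˡ-< (p ℕ.∸ toℕ c′) (ℕ.≰⇒> c′≰c))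

  -- The coefficientwise difference modulo `p`. The vector `ds` is chosen before `bs`, since it
  -- depends on the coefficients alone.
  combination-difference : ∀ {d} (cs cs′ : Vec (Fin p) d) →
    ∃[ ds ] (∀ bs → linearCombination ds bs + linearCombination cs′ bs ≡ linearCombination cs bs)
          × (All (λ c → toℕ c ≡ 0) ds → cs ≡ cs′)
  combination-difference [] [] = [] , (λ { [] → +-identityˡ 0# }) , λ _ → refl
  combination-difference (c ∷ cs) (c′ ∷ cs′) =
    let d  , d+c′≡c , d≡0⇒     = digit-difference c c′
        ds , ds+cs′≡cs , ds≡0⇒ = combination-difference cs cs′
    in d ∷ ds
     , (λ { (x ∷ xs) → begin
         (d · x + linearCombination ds xs) + (c′ · x + linearCombination cs′ xs)
           ≡⟨ solve 4 (λ y z y′ z′ → (y :+ z) :+ (y′ :+ z′) := (y :+ y′) :+ (z :+ z′)) refl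
                (d · x) (linearCombination ds xs) (c′ · x) (linearCombination cs′ xs) ⟩
         (d · x + c′ · x) + (linearCombination ds xs + linearCombination cs′ xs)
           ≡⟨ cong₂ _+_ (d+c′≡c x) (ds+cs′≡cs xs) ⟩
         c · x + linearCombination cs xs ∎ })
     , λ { (d≡0 ∷ ds≡0) → cong₂ _∷_ (d≡0⇒ d≡0) (ds≡0⇒ ds≡0) }

  -- Independence speaks only of combinations equal to `0#`, so it is applied to the difference of
  -- the two coefficient vectors.
  basis⇒injective : ∀ {U d} {bs : Vec Carrier d} → IsBasis U bs →
                    Injective _≡_ _≡_ (λ cs → linearCombination cs bs)
  basis⇒injective {bs = bs} basis {cs} {cs′} eq =
    let ds , ds+cs′≡cs , ds≡0⇒ = combination-difference cs cs′ in
    ds≡0⇒ (IsBasis.independent basis ds (+-cancelʳ (linearCombination cs′ bs) _ _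
      (trans (ds+cs′≡cs bs) (trans eq (sym (+-identityˡ _))))))

  combination∈ : ∀ {U d} {bs : Vec Carrier d} → IsSubspace U → All U bs → ∀ cs → U (linearCombination cs bs)
  combination∈ sub []       []       = IsSubspace.0#-closed sub
  combination∈ sub (h ∷ hs) (c ∷ cs) =
    IsSubspace.+-closed sub _ _ (IsSubspace.·-closed sub c _ h) (combination∈ sub hs cs)

  -- The `p ^ d` digit vectors give as many distinct points of the coset of `y`, too many for all of
  -- them to lie in `xs`.
  avoid-coset : ∀ {U d} → IsSubspace U → HasDimension U d →
                ∀ y xs → length xs ℕ.< p ^ d → ∃[ u ] U u × y + u ∉ xs
  avoid-coset {d = d} sub (bs , basis) y xs xs<p^d =
    let i , ∉xs = avoid _≟_ (λ i → y + linearCombination (digits d i) bs)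
                    (λ eq → digits-injective d (basis⇒injective basis (+-cancelˡ y _ _ eq))) xs xs<p^d
    in linearCombination (digits d i) bs , combination∈ sub (IsBasis.members basis) (digits d i) , ∉xs

  -- The points `x + u` and `x` lie in one coset of `U`, so `f - M` agrees at them, and additivity
  -- of `M` leaves `M u`.
  translation-constant : ∀ {f k} (h : CodimAtMost f k) → let open CodimAtMost h in
                         ∀ {u} → U u → ∀ x → f (x + u) ≡ M u + f x
  translation-constant {f} h {u} u∈U x = begin
    f (x + u)                               ≡⟨ x-y+y≡x (f (x + u)) (M (x + u)) ⟨
    (f (x + u) - M (x + u)) + M (x + u)     ≡⟨ cong₂ _+_
      (f-M-constant (x + u) x (subst U (sym (trans (cong (_- x) (+-comm x u)) (x+y-y≡x u x))) u∈U))
      (IsLinear.+-homo M-linear x u) ⟩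
    (f x - M x) + (M x + M u)               ≡⟨ +-assoc (f x - M x) (M x) (M u) ⟨
    ((f x - M x) + M x) + M u               ≡⟨ cong (_+ M u) (x-y+y≡x (f x) (M x)) ⟩
    f x + M u                               ≡⟨ +-comm (f x) (M u) ⟩
    M u + f x                               ∎
    where open CodimAtMost h

  -- Here `p ^ (n ∸ k)` is the number of elements of `U`.
  carlitzRank⇒codim-bound : ∀ {f r k} → HasCarlitzRank f r → 0 ℕ.< r → 2 ℕ.+ 2 ℕ.* r ℕ.< p ^ n →
                            CodimAtMost f k → p ^ (n ℕ.∸ k) ℕ.≤ r
  carlitzRank⇒codim-bound {f} {r} {k} rank 0<r r<q h = ℕ.≮⇒≥ λ r<∣U∣ → absurd r<∣U∣ (carlitz-fractionalLinear rank)
    where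
    open CodimAtMost h
    absurd : r ℕ.< p ^ (n ℕ.∸ k) → ¬ (∃[ O ] length O ≡ r × FractionalLinearOff O f)
    absurd r<∣U∣ (O , refl , F) with FractionalLinearOff.c F ≟ 0#
    ... | yes c≡0 = carlitzRank>0⇒¬affine rank 0<r α β α≢0 λ x →
          -- The coset of `x` has more points than `O`, so some translate of `x` escapes `O`.
          let u , u∈U , x+u∉O = avoid-coset U-subspace U-dimension x O r<∣U∣
          in affine-at-translate (ℕ.<-trans (ℕ.m<n+m _ {2} ℕ.z<s) r<q) (translation-constant h u∈U) x x+u∉O
      where open Translation.Affine K F c≡0
    ... | no c≢0 =
          -- Since `0 < r`, the subspace has at least two elements. Avoiding the list with sole
          -- entry `0#` yields a nonzero one.
          let u , u∈U , u∉ = avoid-coset U-subspace U-dimension 0# (0# ∷ []) (ℕ.≤-<-trans 0<r r<∣U∣)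
          in Translation.c≢0⇒no-constant-difference K F c≢0 r<q
               (λ u≡0 → u∉ (here (trans (+-identityˡ u) u≡0))) (translation-constant h u∈U)

  codimAtMost-codim : ∀ f → CodimAtMost f (codim f)
  codimAtMost-codim f = Least.holds (proj₂ (leastCodim f))

  codim≤n : ∀ f → codim f ℕ.≤ n
  codim≤n f = CodimAtMost.k≤n (codimAtMost-codim f)

  -- Split `p ^ n` as `p ^ codim f` times `p ^ (n ∸ codim f)` and bound the second factor by `r`.
  q≤AddInd*r : ∀ {f r} → HasCarlitzRank f r → 0 ℕ.< r → 2 ℕ.+ 2 ℕ.* r ℕ.< p ^ n →
               p ^ n ℕ.≤ AddInd f ℕ.* r
  q≤AddInd*r {f} {r} rank 0<r r<q = ℕ.≤-trans
    (ℕ.≤-reflexive (trans (cong (p ^_) (sym (ℕ.m+[n∸m]≡n (codim≤n f))))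
      (ℕ.^-distribˡ-+-* p (codim f) (n ℕ.∸ codim f))))
    (ℕ.*-monoʳ-≤ (p ^ codim f) (carlitzRank⇒codim-bound rank 0<r r<q (codimAtMost-codim f)))

-- Passage to rational numbers and the final bounds

open import Data.Integer.Base using (+_; _-_)
open import Data.Nat.Base using (NonZero; _*_; _>_; _≥_)
open import Data.Nat.Primality using (Prime; prime⇒nonZero)
open import Data.Rational.Base using (_/_; _⊓_) renaming (_≥_ to _≥ℚ_; _≤_ to _≤ℚ_)
open import Function.Definitions using (Bijective)

-- The comparison is made on unnormalised fractions, where the order is cross-multiplication. `mkℚᵘ`
-- stores the denominator minus one, hence the match on `suc`.
/-mono-≤ : ∀ i j m n .{{_ : NonZero m}} .{{_ : NonZero n}} →
           i ℤ.* + n ℤ.≤ j ℤ.* + m → i / m ≤ℚ j / n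
/-mono-≤ i j (suc m) (suc n) i*n≤j*m = ℚ.toℚᵘ-cancel-≤
  (ℚᵘ.≤-respˡ-≃ (ℚᵘ.≃-sym (ℚ.toℚᵘ-fromℚᵘ (ℚᵘ.mkℚᵘ i m)))
    (ℚᵘ.≤-respʳ-≃ (ℚᵘ.≃-sym (ℚ.toℚᵘ-fromℚᵘ (ℚᵘ.mkℚᵘ j n))) (ℚᵘ.*≤* i*n≤j*m)))

theorem2 :
    ∀ (p n : ℕ) → Prime p → n ≥ 1 →
    let q = p ^ n in
    (K : FiniteField q) →
    let open FiniteField K using (Carrier)
        open CarlitzRank K using (HasCarlitzRank)
        open AdditiveIndex p n K using (AddInd) in
    (f : Carrier → Carrier) → Bijective _≡_ _≡_ f →
    (r : ℕ) .{{_ : NonZero r}} → HasCarlitzRank f r →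
    ((+ AddInd f) / 1 ≥ℚ ((+ q) / r) ⊓ ((+ q - + (2 * r)) / 2))
    × (r ≡ 1 → q > 4 → AddInd f ≡ q)
theorem2 p n p-prime _ K f _ r rank = bound , equality
  where
  open AdditiveIndex p n K using (AddInd; codim)
  open Codimension p n K
  instance
    p≢0 : NonZero p
    p≢0 = prime⇒nonZero p-prime

  q = p ^ n
  A = AddInd f

  q/r≤A : 2 ℕ.+ 2 * r ℕ.< q → (+ q) / r ≤ℚ (+ A) / 1
  q/r≤A r<q = /-mono-≤ (+ q) (+ A) r 1
    (subst (ℤ._≤ + A ℤ.* + r) (sym (ℤ.*-identityʳ (+ q)))
      (subst (+ q ℤ.≤_) (ℤ.pos-* A r)
        (ℤ.+≤+ (q≤AddInd*r rank (ℕ.>-nonZero⁻¹ r) r<q))))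

  [q-2r]/2≤A : q ℕ.≤ 2 ℕ.+ 2 * r → (+ q - + (2 * r)) / 2 ≤ℚ (+ A) / 1
  [q-2r]/2≤A q≤2+2r = /-mono-≤ (+ q - + (2 * r)) (+ A) 2 1 (begin
    (+ q - + (2 * r)) ℤ.* + 1               ≡⟨ ℤ.*-identityʳ _ ⟩
    + q - + (2 * r)                         ≤⟨ ℤ.+-monoˡ-≤ (ℤ.- + (2 * r)) (ℤ.+≤+ q≤2+2r) ⟩
    + (2 ℕ.+ 2 * r) - + (2 * r)             ≡⟨ ℤ.+-assoc (+ 2) (+ (2 * r)) (ℤ.- + (2 * r)) ⟩
    + 2 ℤ.+ (+ (2 * r) - + (2 * r))         ≡⟨ cong (ℤ._+_ (+ 2)) (ℤ.+-inverseʳ (+ (2 * r))) ⟩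
    -- The remaining 2 is read as `1 * 2`, and `1 ≤ A` because `A` is a power of the nonzero number
    -- `p`.
    + 1 ℤ.* + 2                             ≤⟨ ℤ.*-monoʳ-≤-nonNeg (+ 2) (ℤ.+≤+ (ℕ.m^n>0 p (codim f))) ⟩
    + A ℤ.* + 2                             ∎)
    where open ℤ.≤-Reasoning

  bound : (+ A) / 1 ≥ℚ ((+ q) / r) ⊓ ((+ q - + (2 * r)) / 2)
  bound with 2 ℕ.+ 2 * r ℕ.<? q
  ... | yes r<q = ℚ.≤-trans (ℚ.p⊓q≤p _ _) (q/r≤A r<q)
  ... | no  r≮q = ℚ.≤-trans (ℚ.p⊓q≤q ((+ q) / r) _) ([q-2r]/2≤A (ℕ.≮⇒≥ r≮q))

  equality : r ≡ 1 → q > 4 → A ≡ q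
  equality refl q>4 = ℕ.≤-antisym (ℕ.^-monoʳ-≤ p (codim≤n f))
    -- For `r ≡ 1` the threshold `2 + 2 * r` computes to 4, so `q > 4` is exactly the required
    -- hypothesis.
    (subst (q ℕ.≤_) (ℕ.*-identityʳ A) (q≤AddInd*r rank ℕ.z<s q>4))
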